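{- (a) Let $0<\alpha\le 1/2$ be a real number. Consider the following statements, quantified over all digraphs $D$, where $n=|V(D)|$: \begin{itemize} \item $\mathrm{III}(\alpha)$: for every digraph $D$, $D$ has a quasi-kernel $Q$ such that $|N^-[Q]|\ge \alpha n$. \item $\mathrm{IV}(\alpha)$: for every digraph $D$, $D$ has a quasi-kernel $Q$ such that $\frac{|Q|}{2}+|N^-(Q)|\ge \alpha n$. \end{itemize} Let $\mathrm{III}^{\mathrm{sf}}(\alpha)$ and $\mathrm{IV}^{\mathrm{sf}}(\alpha)$ denote the sink-free versions, i.e. the statements obtained by restricting to sink-free digraphs $D$. Then $\mathrm{III}(\alpha)$ and $\mathrm{IV}(\alpha)$ are equivalent; moreover $\mathrm{III}(\alpha)$ is equivalent to $\mathrm{III}^{\mathrm{sf}}(\alpha)$, and $\mathrm{IV}(\alpha)$ is equivalent to $\mathrm{IV}^{\mathrm{sf}}(\alpha)$. (b) Every digraph $D$ on $n$ vertices contains an independent set $I$ with $\frac{|I|}{2}+|N^-(I)|\ge \frac{n}{2}$.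
   Context: Digraphs $D=(V(D),A(D))$ are finite, without loops or parallel arcs; a pair of opposite arcs $uv,vu$ (directed 2-cycle) is allowed. If $xy\in A(D)$, then $y$ is an out-neighbor of $x$ and $x$ is an in-neighbor of $y$. A sink is a vertex with no out-neighbors; a digraph is sink-free if it has no sinks. For vertices $u,v$, $\mathrm{dist}(u,v)\in\mathbb{Z}^{\ge 0}\cup\{\infty\}$ is the length of a shortest directed path from $u$ to $v$, and for $S\subseteq V(D)$, $\mathrm{dist}(u,S)=\min_{v\in S}\mathrm{dist}(u,v)$ (equal to $\infty$ if $S=\emptyset$). Define $N^-(S)=\{u\in V(D):\mathrm{dist}(u,S)=1\}$ and $N^-[S]=\{u\in V(D):\mathrm{dist}(u,S)\le 1\}$; in particular $N^-(S)\cap S=\emptyset$. A set of vertices is independent if there is no arc between any two of its vertices. A quasi-kernel of $D$ is an independent set $Q\subseteq V(D)$ such that $\mathrm{dist}(u,Q)\le 2$ for every $u\in V(D)$. -}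

module Defs where

open import Data.Fin using (Fin; zero; suc)
open import Data.Fin.Properties as Fin using (any?)
open import Data.Fin.Subset using (Subset; _∈_; ∣_∣)
open import Data.Fin.Subset.Properties using (_∈?_)
open import Data.Integer using (+_)
open import Data.List as List using (List; allFin; upTo)
import Data.List.Extrema
open import Data.Nat as ℕ using (ℕ; zero; suc)
import Data.Nat.Properties as ℕ
open import Data.Product using (∃; _×_; _,_)
open import Data.Rational as ℚ using (ℚ; 0ℚ; 1ℚ; _/_)
import Data.Rational.Properties as ℚ
open import Data.Vec as Vec using (Vec; []; _∷_; head; last; tabulate)
open import Data.Vec.Relation.Unary.AllPairs using (allPairs?)
open import Data.Vec.Relation.Unary.Linked using (Linked; linked?)
open import Data.Vec.Relation.Unary.Unique.Propositional using (Unique)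
open import Level using (0ℓ)
open import Relation.Binary.Bundles using (TotalOrder)
open import Relation.Binary.Core using (Rel)
open import Relation.Binary.Definitions using (Decidable; Irreflexive)
import Relation.Binary.Construct.Add.Supremum.NonStrict as Sup
open import Relation.Binary.PropositionalEquality
  using (_≡_; refl; sym; trans; cong; cong₂; subst; module ≡-Reasoning)
open import Relation.Nullary using (¬_; Dec; yes; no; does; ¬?)
open import Relation.Nullary.Construct.Add.Supremum using (_⁺; [_]; ⊤⁺; ≡-dec)
open import Relation.Nullary.Decidable using (_×-dec_; map′)

-- A real number is presented by a Cauchy sequence of rationals together with
-- a modulus (the witnesses N below). Two presentations denote the same real
-- when each is ≤ᴿ the other; nothing below depends on the presentation.

record ℝ : Set where
  field
    approx : ℕ → ℚ
    cauchy : ∀ ε → 0ℚ ℚ.< ε → ∃ λ N → ∀ m n → N ℕ.≤ m → N ℕ.≤ n →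
             ℚ.∣ approx m ℚ.- approx n ∣ ℚ.< ε

open ℝ public

infix 4 _≤ᴿ_ _<ᴿ_

_≤ᴿ_ : Rel ℝ 0ℓ
x ≤ᴿ y = ∀ ε → 0ℚ ℚ.< ε → ∃ λ N → ∀ n → N ℕ.≤ n →
         approx x n ℚ.≤ approx y n ℚ.+ ε

_<ᴿ_ : Rel ℝ 0ℓ
x <ᴿ y = ∃ λ ε → 0ℚ ℚ.< ε × ∃ λ N → ∀ n → N ℕ.≤ n →
         approx x n ℚ.+ ε ℚ.≤ approx y n

fromℚ : ℚ → ℝ
fromℚ q = record
  { approx = λ _ → q
  ; cauchy = λ ε 0<ε → 0 , λ _ _ _ _ →
      subst (ℚ._< ε) (sym (cong ℚ.∣_∣ (ℚ.+-inverseʳ q))) 0<ε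
  }

private
  bounded : (x : ℝ) → ∃ λ B → 0ℚ ℚ.< B × ∃ λ N → ∀ n → N ℕ.≤ n →
            ℚ.∣ approx x n ∣ ℚ.≤ B
  bounded x with cauchy x 1ℚ (ℚ.positive⁻¹ 1ℚ)
  ... | N , close = 1ℚ ℚ.+ ℚ.∣ a ∣
                  , ℚ.+-mono-<-≤ (ℚ.positive⁻¹ 1ℚ) (ℚ.0≤∣p∣ a)
                  , N , bound
    where
    a = approx x N
    open ℚ.≤-Reasoning
    bound : ∀ n → N ℕ.≤ n → ℚ.∣ approx x n ∣ ℚ.≤ 1ℚ ℚ.+ ℚ.∣ a ∣
    bound n N≤n = let b = approx x n in begin
      ℚ.∣ b ∣                     ≡⟨ cong ℚ.∣_∣ (ℚ.+-identityʳ b) ⟨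
      ℚ.∣ b ℚ.+ 0ℚ ∣              ≡⟨ cong (λ z → ℚ.∣ b ℚ.+ z ∣) (ℚ.+-inverseˡ a) ⟨
      ℚ.∣ b ℚ.+ (ℚ.- a ℚ.+ a) ∣   ≡⟨ cong ℚ.∣_∣ (ℚ.+-assoc b (ℚ.- a) a) ⟨
      ℚ.∣ (b ℚ.- a) ℚ.+ a ∣       ≤⟨ ℚ.∣p+q∣≤∣p∣+∣q∣ (b ℚ.- a) a ⟩
      ℚ.∣ b ℚ.- a ∣ ℚ.+ ℚ.∣ a ∣   ≤⟨ ℚ.+-monoˡ-≤ ℚ.∣ a ∣ (ℚ.<⇒≤ (close n N N≤n ℕ.≤-refl)) ⟩
      1ℚ ℚ.+ ℚ.∣ a ∣              ∎

  product-difference : ∀ a b c d →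
    a ℚ.* b ℚ.- c ℚ.* d ≡ a ℚ.* (b ℚ.- d) ℚ.+ (a ℚ.- c) ℚ.* d
  product-difference a b c d = sym (begin
    a ℚ.* (b ℚ.- d) ℚ.+ (a ℚ.- c) ℚ.* d
      ≡⟨ cong₂ ℚ._+_ (ℚ.*-distribˡ-+ a b (ℚ.- d)) (ℚ.*-distribʳ-+ d a (ℚ.- c)) ⟩
    (a ℚ.* b ℚ.+ a ℚ.* (ℚ.- d)) ℚ.+ (a ℚ.* d ℚ.+ (ℚ.- c) ℚ.* d)
      ≡⟨ cong₂ (λ s t → (a ℚ.* b ℚ.+ s) ℚ.+ (a ℚ.* d ℚ.+ t))
           (sym (ℚ.neg-distribʳ-* a d)) (sym (ℚ.neg-distribˡ-* c d)) ⟩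
    (a ℚ.* b ℚ.- a ℚ.* d) ℚ.+ (a ℚ.* d ℚ.- c ℚ.* d)
      ≡⟨ ℚ.+-assoc (a ℚ.* b) _ _ ⟩
    a ℚ.* b ℚ.+ (ℚ.- (a ℚ.* d) ℚ.+ (a ℚ.* d ℚ.- c ℚ.* d))
      ≡⟨ cong (a ℚ.* b ℚ.+_) (ℚ.+-assoc (ℚ.- (a ℚ.* d)) (a ℚ.* d) _) ⟨
    a ℚ.* b ℚ.+ ((ℚ.- (a ℚ.* d) ℚ.+ a ℚ.* d) ℚ.- c ℚ.* d)
      ≡⟨ cong (λ z → a ℚ.* b ℚ.+ (z ℚ.- c ℚ.* d)) (ℚ.+-inverseˡ (a ℚ.* d)) ⟩
    a ℚ.* b ℚ.+ (0ℚ ℚ.- c ℚ.* d)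
      ≡⟨ cong (a ℚ.* b ℚ.+_) (ℚ.+-identityˡ _) ⟩
    a ℚ.* b ℚ.- c ℚ.* d ∎)
    where open ≡-Reasoning

  divide : ∀ D ε → 0ℚ ℚ.< D → 0ℚ ℚ.< ε → ∃ λ δ → 0ℚ ℚ.< δ × D ℚ.* δ ≡ ε
  divide D ε 0<D 0<ε = ε ℚ.* D⁻¹ , ℚ.positive⁻¹ _ {{ℚ.pos*pos⇒pos ε D⁻¹}} , (begin
    D ℚ.* (ε ℚ.* D⁻¹)   ≡⟨ ℚ.*-comm D _ ⟩
    ε ℚ.* D⁻¹ ℚ.* D     ≡⟨ ℚ.*-assoc ε _ _ ⟩
    ε ℚ.* (D⁻¹ ℚ.* D)   ≡⟨ cong (ε ℚ.*_) (ℚ.*-inverseˡ D) ⟩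
    ε ℚ.* 1ℚ            ≡⟨ ℚ.*-identityʳ ε ⟩
    ε                   ∎)
    where
    open ≡-Reasoning
    instance
      D>0 : ℚ.Positive D
      D>0 = ℚ.positive 0<D
      D≢0 : ℚ.NonZero D
      D≢0 = ℚ.pos⇒nonZero D
      ε>0 : ℚ.Positive ε
      ε>0 = ℚ.positive 0<ε
    D⁻¹ : ℚ
    D⁻¹ = ℚ.1/ D
    instance
      D⁻¹>0 : ℚ.Positive D⁻¹
      D⁻¹>0 = ℚ.1/pos⇒pos D

  *-cauchy : (x y : ℝ) → ∀ ε → 0ℚ ℚ.< ε → ∃ λ N → ∀ m n → N ℕ.≤ m → N ℕ.≤ n →
    ℚ.∣ approx x m ℚ.* approx y m ℚ.- approx x n ℚ.* approx y n ∣ ℚ.< ε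
  *-cauchy x y ε 0<ε
    with bounded x | bounded y
  ... | B , 0<B , M , x≤B | C , 0<C , M′ , y≤C
    with divide (B ℚ.+ C) ε (ℚ.+-mono-< 0<B 0<C) 0<ε
  ... | δ , 0<δ , Dδ≡ε
    with cauchy x δ 0<δ | cauchy y δ 0<δ
  ... | K , closeˣ | K′ , closeʸ = N , λ m n N≤m N≤n →
    let xₘ = approx x m ; xₙ = approx x n
        yₘ = approx y m ; yₙ = approx y n
        instance
          B>0 = ℚ.positive 0<B
          C>0 = ℚ.positive 0<C
          nn₁ = ℚ.∣-∣-nonNeg (yₘ ℚ.- yₙ)
          nn₂ = ℚ.∣-∣-nonNeg (xₘ ℚ.- xₙ)
    in begin-strict
      ℚ.∣ xₘ ℚ.* yₘ ℚ.- xₙ ℚ.* yₙ ∣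
        ≡⟨ cong ℚ.∣_∣ (product-difference xₘ yₘ xₙ yₙ) ⟩
      ℚ.∣ xₘ ℚ.* (yₘ ℚ.- yₙ) ℚ.+ (xₘ ℚ.- xₙ) ℚ.* yₙ ∣
        ≤⟨ ℚ.∣p+q∣≤∣p∣+∣q∣ (xₘ ℚ.* (yₘ ℚ.- yₙ)) _ ⟩
      ℚ.∣ xₘ ℚ.* (yₘ ℚ.- yₙ) ∣ ℚ.+ ℚ.∣ (xₘ ℚ.- xₙ) ℚ.* yₙ ∣
        ≡⟨ cong₂ ℚ._+_ (ℚ.∣p*q∣≡∣p∣*∣q∣ xₘ _)
             (trans (ℚ.∣p*q∣≡∣p∣*∣q∣ (xₘ ℚ.- xₙ) yₙ) (ℚ.*-comm ℚ.∣ xₘ ℚ.- xₙ ∣ ℚ.∣ yₙ ∣)) ⟩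
      ℚ.∣ xₘ ∣ ℚ.* ℚ.∣ yₘ ℚ.- yₙ ∣ ℚ.+ ℚ.∣ yₙ ∣ ℚ.* ℚ.∣ xₘ ℚ.- xₙ ∣
        ≤⟨ ℚ.+-mono-≤ (ℚ.*-monoʳ-≤-nonNeg ℚ.∣ yₘ ℚ.- yₙ ∣ (x≤B m (ℕ.≤-trans M≤N N≤m)))
                      (ℚ.*-monoʳ-≤-nonNeg ℚ.∣ xₘ ℚ.- xₙ ∣ (y≤C n (ℕ.≤-trans M′≤N N≤n))) ⟩
      B ℚ.* ℚ.∣ yₘ ℚ.- yₙ ∣ ℚ.+ C ℚ.* ℚ.∣ xₘ ℚ.- xₙ ∣
        <⟨ ℚ.+-mono-< (ℚ.*-monoʳ-<-pos B (closeʸ m n (ℕ.≤-trans K′≤N N≤m) (ℕ.≤-trans K′≤N N≤n)))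
                      (ℚ.*-monoʳ-<-pos C (closeˣ m n (ℕ.≤-trans K≤N N≤m) (ℕ.≤-trans K≤N N≤n))) ⟩
      B ℚ.* δ ℚ.+ C ℚ.* δ
        ≡⟨ ℚ.*-distribʳ-+ δ B C ⟨
      (B ℚ.+ C) ℚ.* δ
        ≡⟨ Dδ≡ε ⟩
      ε ∎
    where
    open ℚ.≤-Reasoning
    N = (M ℕ.⊔ M′) ℕ.⊔ (K ℕ.⊔ K′)
    M≤N : M ℕ.≤ N
    M≤N = ℕ.m≤n⇒m≤n⊔o (K ℕ.⊔ K′) (ℕ.m≤m⊔n M M′)
    M′≤N : M′ ℕ.≤ N
    M′≤N = ℕ.m≤n⇒m≤n⊔o (K ℕ.⊔ K′) (ℕ.m≤n⊔m M M′)
    K≤N : K ℕ.≤ N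
    K≤N = ℕ.m≤n⇒m≤o⊔n (M ℕ.⊔ M′) (ℕ.m≤m⊔n K K′)
    K′≤N : K′ ℕ.≤ N
    K′≤N = ℕ.m≤n⇒m≤o⊔n (M ℕ.⊔ M′) (ℕ.m≤n⊔m K K′)

infixl 7 _*ᴿ_

_*ᴿ_ : ℝ → ℝ → ℝ
x *ᴿ y = record
  { approx = λ n → approx x n ℚ.* approx y n
  ; cauchy = *-cauchy x y
  }

record Digraph : Set₁ where
  field
    order    : ℕ
    Arc      : Rel (Fin order) 0ℓ
    arc?     : Decidable Arc
    loopless : Irreflexive _≡_ Arc

  Vertex : Set
  Vertex = Fin order

-- ℤ≥0 ∪ {∞}, with ∞ = ⊤⁺.
ℕ∞ : Set
ℕ∞ = ℕ ⁺

open Sup ℕ._≤_ public using () renaming (_≤⁺_ to _≤∞_; ≤⁺-dec to ≤∞-dec)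

ℕ∞-totalOrder : TotalOrder 0ℓ 0ℓ 0ℓ
ℕ∞-totalOrder = record
  { isTotalOrder = Sup.≤⁺-isTotalOrder-≡ ℕ._≤_ ℕ.≤-isTotalOrder }

-- The minimum of the empty list is ∞.
minimum : List ℕ∞ → ℕ∞
minimum = Data.List.Extrema.min ℕ∞-totalOrder ⊤⁺

anyVec? : ∀ {n} k {P : Vec (Fin n) k → Set} → (∀ xs → Dec (P xs)) → Dec (∃ P)
anyVec? zero    P? = map′ (λ p → [] , p) (λ { ([] , p) → p }) (P? [])
anyVec? (suc k) P? =
  map′ (λ { (x , xs , p) → x ∷ xs , p }) (λ { (x ∷ xs , p) → x , xs , p })
       (any? (λ x → anyVec? k (λ xs → P? (x ∷ xs))))

subset : ∀ {n} {P : Fin n → Set} → (∀ u → Dec (P u)) → Subset n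
subset P? = tabulate (λ u → does (P? u))

module _ (D : Digraph) where
  open Digraph D

  -- A directed path of length k visits k + 1 distinct vertices.
  IsPath : Vertex → Vertex → (k : ℕ) → Vec Vertex (suc k) → Set
  IsPath u v k xs = head xs ≡ u × last xs ≡ v × Linked Arc xs × Unique xs

  Path : Vertex → Vertex → ℕ → Set
  Path u v k = ∃ (IsPath u v k)

  path? : ∀ u v k → Dec (Path u v k)
  path? u v k = anyVec? (suc k) λ xs →
    (head xs Fin.≟ u) ×-dec (last xs Fin.≟ v) ×-dec
    linked? arc? xs ×-dec allPairs? (λ x y → ¬? (x Fin.≟ y)) xs

  -- Vertices on a path are distinct, so every path has length below the order.
  dist : Vertex → Vertex → ℕ∞
  dist u v = minimum (List.map [_] (List.filter (path? u v) (upTo order)))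

  distTo : Vertex → Subset order → ℕ∞
  distTo u S = minimum (List.map (dist u) (List.filter (_∈? S) (allFin order)))

  N⁻ : Subset order → Subset order
  N⁻ S = subset (λ u → ≡-dec ℕ._≟_ (distTo u S) [ 1 ])

  N⁻[_] : Subset order → Subset order
  N⁻[ S ] = subset (λ u → ≤∞-dec ℕ._≤?_ (distTo u S) [ 1 ])

  Independent : Subset order → Set
  Independent S = ∀ u v → u ∈ S → v ∈ S → ¬ Arc u v

  QuasiKernel : Subset order → Set
  QuasiKernel Q = Independent Q × (∀ u → distTo u Q ≤∞ [ 2 ])

  Sink : Vertex → Set
  Sink u = ∀ v → ¬ Arc u v

  SinkFree : Set
  SinkFree = ∀ u → ¬ Sink u

open Digraph using (order)

fromℕ : ℕ → ℚ
fromℕ n = + n / 1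

half : ℕ → ℚ
half n = + n / 2

LargeClosedNbhd : ℝ → Digraph → Set
LargeClosedNbhd α D = ∃ λ (Q : Subset (order D)) → QuasiKernel D Q ×
  α *ᴿ fromℚ (fromℕ (order D)) ≤ᴿ fromℚ (fromℕ ∣ N⁻[_] D Q ∣)

LargeWeightedNbhd : ℝ → Digraph → Set
LargeWeightedNbhd α D = ∃ λ (Q : Subset (order D)) → QuasiKernel D Q ×
  α *ᴿ fromℚ (fromℕ (order D)) ≤ᴿ fromℚ (half ∣ Q ∣ ℚ.+ fromℕ ∣ N⁻ D Q ∣)

III IV IIIˢᶠ IVˢᶠ : ℝ → Set₁
III  α = (D : Digraph) → LargeClosedNbhd α D
IV   α = (D : Digraph) → LargeWeightedNbhd α D
IIIˢᶠ α = (D : Digraph) → SinkFree D → LargeClosedNbhd α D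
IVˢᶠ α = (D : Digraph) → SinkFree D → LargeWeightedNbhd α D

{-# OPTIONS --safe #-}
module Submission where

-- All the equivalences reduce to one implication: the sink-free closed
-- bound III^sf(α) yields the weighted bound IV(α) for every digraph. The
-- others are restriction to sink-free digraphs, and the passage from IV to
-- III, where N⁻[Q] is the disjoint union of Q and N⁻(Q) (∣N⁻[]∣), so that
-- ∣N⁻[Q]∣ is at least ∣Q∣/2 + ∣N⁻(Q)∣ (weighted⇒closed).
--
-- For the implication, replace every vertex of D by a directed 3-cycle and
-- every arc by all nine arcs between the two cycles. The result is
-- sink-free, has 3n vertices, and every quasi-kernel Q⁺ of it has a shadow
-- Q in D (the vertices whose cycle meets Q⁺) which is again a quasi-kernel.
-- As Q⁺ is independent it picks one vertex from each cycle over Q, so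
-- ∣Q⁺∣ ≤ ∣Q∣ and ∣N⁻(Q⁺)∣ ≤ ∣Q∣ + 3∣N⁻(Q)∣. Hence the weight
-- w(Q) = ∣Q∣ + 2∣N⁻(Q)∣ satisfies w(Q⁺) ≤ 3 w(Q) (weight≤): it grows at most
-- like the number of vertices, while the size ∣Q⁺∣ does not grow at all.
-- After k iterations 2∣N⁻[Q⁺]∣ = ∣Q⁺∣ + w(Q⁺) ≤ n + 3^k w(Q) (tower-N⁻[]).
-- Applying III^sf to the k-fold blow-up and dividing by 2 · 3^k gives
-- αn ≤ w(Q)/2 + n/(2 · 3^k) up to an arbitrarily small error (descale).
-- There are finitely many quasi-kernels, so one of maximal weight exists
-- (argmax); it satisfies this for all k, hence αn ≤ w(Q)/2.
--
-- For the independent set, some vertex v of a nonempty digraph has in-degree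
-- i no smaller than its out-degree, by double counting the arcs
-- (∃-outdeg≤indeg). Delete v and its neighbours, at most 1 + 2i vertices,
-- find I recursively in the rest and add v to it: twice ∣I∣/2 + ∣N⁻(I)∣
-- grows by at least 1 + 2i (large-independent).

open import Defs
open import Data.Bool using (if_then_else_)
open import Data.Fin using (Fin; zero; suc; combine; quotient; remainder)
open import Data.Fin.Patterns using (0F; 1F; 2F)
import Data.Fin.Properties as Fin
open import Data.Fin.Subset using
  (Subset; ∣_∣; _∈_; _∉_; _⊆_; _⊂_; _∩_; _∪_; ⁅_⁆; ⊤; Nonempty; inside; outside)
open import Data.Fin.Subset.Induction using (Acc; acc; ⊂-wellFounded)
open import Data.Fin.Subset.Properties
  using (_∈?_; ∣⊤∣≡n; ∣p∣≤n; nonempty?; x∈p∩q⁺; x∈p∩q⁻; ∣p∩q∣≤∣q∣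
        ; x∈p∪q⁺; x∈p∪q⁻; x∈⁅x⁆; x∈⁅y⁆⇒x≡y)
open import Data.Integer using (+[1+_]; -[1+_])
import Data.Integer as ℤ
import Data.Integer.Properties as ℤ
open import Data.List as List using (List; allFin; upTo)
open import Data.List.Membership.Propositional as List using (lose)
open import Data.List.Membership.Propositional.Properties
  using (∈-map⁺; ∈-map⁻; ∈-filter⁺; ∈-filter⁻; ∈-upTo⁺; ∈-allFin)
open import Data.List.Extrema ℕ∞-totalOrder using (min≤v⁺; argmin-sel)
open import Data.Nat as ℕ using (ℕ; zero; suc; z≤n; s≤s)
import Data.Nat.Properties as ℕ
import Data.Nat.Tactic.RingSolver as ℕ-Ring
open import Data.Product using (∃; _×_; _,_; proj₁; proj₂; map₂)
open import Data.Rational using (ℚ; 0ℚ; 1ℚ; ½; _+_; _*_; _≤_; _<_)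
import Data.Rational as ℚ
import Data.Rational.Properties as ℚ
import Data.Rational.Solver as ℚ-Ring
open import Data.Rational.Unnormalised as ℚᵘ using (mkℚᵘ; *≡*; *≤*)
import Data.Rational.Unnormalised.Properties as ℚᵘ
open import Data.Sum as Sum using (_⊎_; inj₁; inj₂; [_,_]′)
open import Data.Vec using (Vec; []; _∷_; head; last)
open import Data.Vec.Properties using (lookup∘tabulate; []=⇒lookup; lookup⇒[]=)
open import Data.Vec.Relation.Unary.All using ([]; _∷_)
open import Data.Vec.Relation.Unary.AllPairs using ([]; _∷_)
open import Data.Vec.Relation.Unary.Linked using (Linked; [-]; _∷_)
open import Data.Vec.Relation.Unary.Unique.Propositional.Properties using (lookup-injective)
open import Function.Base using (_∘_; id; const; case_of_)
open import Function.Bundles using (_⇔_; mk⇔)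
open import Relation.Binary.PropositionalEquality
open import Relation.Nullary using (¬_; Dec; yes; no; does; ¬?; contradiction)
open import Relation.Nullary.Construct.Add.Supremum using ([_]; ⊤⁺; ≡-dec)
open import Relation.Nullary.Decidable
  using (_×-dec_; _⊎-dec_; _→-dec_; dec-true; from-yes)
open import Relation.Binary.Construct.Add.Supremum.NonStrict ℕ._≤_
  using ([_]; ≤⁺-trans; [≤]-injective)
open import Algebra.Properties.CommutativeMonoid.Sum ℕ.+-0-commutativeMonoid
  using (sum; ∑-distrib-+; ∑-comm)
open Digraph using (order)

-- Membership in a set given by a decision procedure

module _ {n} {P : Fin n → Set} (P? : ∀ u → Dec (P u)) where

  ∈-subset⁺ : ∀ {u} → P u → u ∈ subset P?
  ∈-subset⁺ {u} p = lookup⇒[]= u _ (trans (lookup∘tabulate _ u) (dec-true (P? u) p))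

  ∈-subset⁻ : ∀ {u} → u ∈ subset P? → P u
  ∈-subset⁻ {u} u∈ with P? u in eq
  ... | yes p = p
  ... | no _  = case trans (sym ([]=⇒lookup u∈))
                           (trans (lookup∘tabulate _ u) (cong does eq)) of λ ()

-- Distances and walks

-- A minimum is at most the finite bound k exactly when some member is; the
-- bound being finite excludes the empty list, whose minimum is ∞.
module _ {A : Set} (f : A → ℕ∞) {P : A → Set} (P? : ∀ x → Dec (P x))
         {xs : List A} {k : ℕ} where

  minimum≤⁺ : ∀ {x} → x List.∈ xs → P x → f x ≤∞ [ k ] →
              minimum (List.map f (List.filter P? xs)) ≤∞ [ k ]
  minimum≤⁺ x∈xs px fx≤k =
    min≤v⁺ ⊤⁺ _ (inj₂ (lose (∈-map⁺ f (∈-filter⁺ P? x∈xs px)) fx≤k))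

  minimum≤⁻ : minimum (List.map f (List.filter P? xs)) ≤∞ [ k ] →
              ∃ λ x → P x × f x ≤∞ [ k ]
  minimum≤⁻ m≤k with argmin-sel id ⊤⁺ (List.map f (List.filter P? xs))
  ... | inj₁ m≡⊤ = case subst (_≤∞ [ k ]) m≡⊤ m≤k of λ ()
  ... | inj₂ m∈ with x , x∈ , m≡fx ← ∈-map⁻ f m∈ =
    x , proj₂ (∈-filter⁻ P? {xs = xs} x∈) , subst (_≤∞ [ k ]) m≡fx m≤k

module _ (D : Digraph) where
  open Digraph D using (Vertex; Arc; loopless)

  -- The vertices of a path are distinct, so the range of lengths over which
  -- dist minimises contains every path.
  path-length< : ∀ {u v k} → Path D u v k → k ℕ.< order D
  path-length< (_ , _ , _ , _ , distinct) =
    Fin.injective⇒≤ (lookup-injective distinct _ _)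

  distTo≤⁺ : ∀ {u v S j k} → v ∈ S → Path D u v j → j ℕ.≤ k → distTo D u S ≤∞ [ k ]
  distTo≤⁺ {u} {v} {S} {j} v∈S p j≤k =
    minimum≤⁺ (dist D u) (_∈? S) (∈-allFin v) v∈S
      (minimum≤⁺ [_] (path? D u v) (∈-upTo⁺ (path-length< p)) p [ j≤k ])

  distTo≤⁻ : ∀ {u S k} → distTo D u S ≤∞ [ k ] →
             ∃ λ v → v ∈ S × ∃ λ j → j ℕ.≤ k × Path D u v j
  distTo≤⁻ {u} {S} d≤k
    with v , v∈S , uv≤k ← minimum≤⁻ (dist D u) (_∈? S) {allFin (order D)} d≤k
    with j , p , j≤k ← minimum≤⁻ [_] (path? D u v) {upTo (order D)} uv≤k
    = v , v∈S , j , [≤]-injective j≤k , p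

  -- u ⇝[ k ] S: some walk with at most k arcs leads from u into S. Unlike on
  -- a path, vertices may be repeated, which suits images under projections.
  _⇝[_]_ : Vertex → ℕ → Subset (order D) → Set
  u ⇝[ zero  ] S = u ∈ S
  u ⇝[ suc k ] S = u ⇝[ k ] S ⊎ ∃ λ v → Arc u v × v ⇝[ k ] S

  ⇝-≤ : ∀ {u S j k} → j ℕ.≤ k → u ⇝[ j ] S → u ⇝[ k ] S
  ⇝-≤ {j = zero}  {zero}  _         w = w
  ⇝-≤ {j = zero}  {suc k} _         w = inj₁ (⇝-≤ {k = k} z≤n w)
  ⇝-≤ {j = suc j} {suc k} (s≤s j≤k) w = Sum.map (⇝-≤ j≤k) (map₂ (map₂ (⇝-≤ j≤k))) w

  linked⇒⇝ : ∀ {S} k (xs : Vec Vertex (suc k)) →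
             Linked Arc xs → last xs ∈ S → head xs ⇝[ k ] S
  linked⇒⇝ zero    (x ∷ [])     _       x∈S = x∈S
  linked⇒⇝ (suc k) (x ∷ y ∷ xs) (a ∷ l) z∈S = inj₂ (y , a , linked⇒⇝ k (y ∷ xs) l z∈S)

  distTo⇒⇝ : ∀ {u S} k → distTo D u S ≤∞ [ k ] → u ⇝[ k ] S
  distTo⇒⇝ k d≤k with distTo≤⁻ d≤k
  ... | v , v∈S , j , j≤k , xs , refl , refl , l , _ = ⇝-≤ j≤k (linked⇒⇝ j xs l v∈S)

  -- Conversely, walks of length at most 2 into S give distance at most 2.

  arc⇒≢ : ∀ {u v} → Arc u v → u ≢ v
  arc⇒≢ a u≡v = loopless u≡v a

  ⇝⇒distTo₀ : ∀ {u S} → u ∈ S → distTo D u S ≤∞ [ 0 ]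
  ⇝⇒distTo₀ {u} u∈S = distTo≤⁺ u∈S (u ∷ [] , refl , refl , [-] , [] ∷ []) z≤n

  ⇝⇒distTo₁ : ∀ {u S} → u ⇝[ 1 ] S → distTo D u S ≤∞ [ 1 ]
  ⇝⇒distTo₁ {u} (inj₁ u∈S) = distTo≤⁺ u∈S (u ∷ [] , refl , refl , [-] , [] ∷ []) z≤n
  ⇝⇒distTo₁ {u} (inj₂ (v , a , v∈S)) =
    distTo≤⁺ v∈S (u ∷ v ∷ [] , refl , refl , a ∷ [-] , (arc⇒≢ a ∷ []) ∷ [] ∷ []) ℕ.≤-refl

  ⇝⇒distTo₂ : ∀ {u S} → u ⇝[ 2 ] S → distTo D u S ≤∞ [ 2 ]
  ⇝⇒distTo₂ (inj₁ w) = ≤⁺-trans ℕ.≤-trans (⇝⇒distTo₁ w) [ ℕ.n≤1+n 1 ]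
  ⇝⇒distTo₂ (inj₂ (v , a , inj₁ v∈S)) = ⇝⇒distTo₂ (inj₁ (inj₂ (v , a , v∈S)))
  ⇝⇒distTo₂ {u} (inj₂ (v , a , inj₂ (w , b , w∈S))) with u Fin.≟ w
  -- The walk closes up into a directed 2-cycle, so u itself lies in S.
  ... | yes refl = ⇝⇒distTo₂ (inj₁ (inj₁ w∈S))
  ... | no u≢w   = distTo≤⁺ w∈S
    (u ∷ v ∷ w ∷ [] , refl , refl , a ∷ b ∷ [-]
    , (arc⇒≢ a ∷ u≢w ∷ []) ∷ (arc⇒≢ b ∷ []) ∷ [] ∷ []) ℕ.≤-refl

  -- Membership in N⁻[S] and N⁻(S) in terms of arcs.

  ∈N⁻[]⁺ : ∀ {u S} → u ⇝[ 1 ] S → u ∈ N⁻[_] D S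
  ∈N⁻[]⁺ {S = S} w = ∈-subset⁺ (λ u → ≤∞-dec ℕ._≤?_ (distTo D u S) [ 1 ]) (⇝⇒distTo₁ w)

  ∈N⁻[]⁻ : ∀ {u S} → u ∈ N⁻[_] D S → u ⇝[ 1 ] S
  ∈N⁻[]⁻ {S = S} u∈ =
    distTo⇒⇝ 1 (∈-subset⁻ (λ u → ≤∞-dec ℕ._≤?_ (distTo D u S) [ 1 ]) u∈)

  ∈N⁻⁺ : ∀ {u v S} → u ∉ S → Arc u v → v ∈ S → u ∈ N⁻ D S
  ∈N⁻⁺ {u} {v} {S} u∉S a v∈S =
    ∈-subset⁺ (λ u → ≡-dec ℕ._≟_ (distTo D u S) [ 1 ])
      (exactly-1 (⇝⇒distTo₁ (inj₂ (v , a , v∈S))) (u∉S ∘ distTo⇒⇝ 0))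
    where
    exactly-1 : ∀ {d} → d ≤∞ [ 1 ] → ¬ d ≤∞ [ 0 ] → d ≡ [ 1 ]
    exactly-1 [ z≤n     ] d≰0 = contradiction [ z≤n ] d≰0
    exactly-1 [ s≤s z≤n ] _   = refl

  ∈N⁻⁻ : ∀ {u S} → u ∈ N⁻ D S → u ∉ S × ∃ λ v → Arc u v × v ∈ S
  ∈N⁻⁻ {u} {S} u∈ = u∉S ,
    [ (λ u∈S → contradiction u∈S u∉S) , id ]′
      (distTo⇒⇝ 1 (subst (_≤∞ [ 1 ]) (sym d≡1) [ ℕ.≤-refl ]))
    where
    d≡1 : distTo D u S ≡ [ 1 ]
    d≡1 = ∈-subset⁻ (λ u → ≡-dec ℕ._≟_ (distTo D u S) [ 1 ]) u∈
    u∉S : u ∉ S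
    u∉S u∈S with subst (_≤∞ [ 0 ]) d≡1 (⇝⇒distTo₀ u∈S)
    ... | [ () ]

-- Counting by indicator sums

private variable
  A B C : Set

-- The indicator of a decided proposition.
⟦_⟧ : Dec A → ℕ
⟦ a? ⟧ = if does a? then 1 else 0

⟦⟧-mono : (a? : Dec A) (b? : Dec B) → (A → B) → ⟦ a? ⟧ ℕ.≤ ⟦ b? ⟧
⟦⟧-mono (no _)  _       _ = z≤n
⟦⟧-mono (yes _) (yes _) _ = ℕ.≤-refl
⟦⟧-mono (yes a) (no ¬b) f = contradiction (f a) ¬b

⟦⟧-disjoint : (a? : Dec A) (b? : Dec B) (c? : Dec C) →
              (A → C) → (B → C) → (A → ¬ B) → ⟦ a? ⟧ ℕ.+ ⟦ b? ⟧ ℕ.≤ ⟦ c? ⟧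
⟦⟧-disjoint (no _)  b?      c? f g h = ⟦⟧-mono b? c? g
⟦⟧-disjoint (yes a) (yes b) c? f g h = contradiction b (h a)
⟦⟧-disjoint (yes a) (no _)  c? f g h = ⟦⟧-mono (yes a) c? f

⟦⟧-cover : (a? : Dec A) (b? : Dec B) (c? : Dec C) →
           (C → A ⊎ B) → ⟦ c? ⟧ ℕ.≤ ⟦ a? ⟧ ℕ.+ ⟦ b? ⟧
⟦⟧-cover a?      b? (no _)  f = z≤n
⟦⟧-cover (yes _) b? (yes _) f = s≤s z≤n
⟦⟧-cover (no ¬a) b? (yes c) f =
  ⟦⟧-mono (yes c) b? λ c → [ (λ a → contradiction a ¬a) , id ]′ (f c)

sum-mono : ∀ {n} {f g : Fin n → ℕ} → (∀ u → f u ℕ.≤ g u) → sum f ℕ.≤ sum g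
sum-mono {zero}  f≤g = z≤n
sum-mono {suc n} f≤g = ℕ.+-mono-≤ (f≤g zero) (sum-mono (f≤g ∘ suc))

sum-mono-< : ∀ {n} {f g : Fin n → ℕ} → (∀ u → f u ℕ.≤ g u) →
             ∀ v → f v ℕ.< g v → sum f ℕ.< sum g
sum-mono-< {suc n} f≤g zero    f<g = ℕ.+-mono-<-≤ f<g (sum-mono (f≤g ∘ suc))
sum-mono-< {suc n} f≤g (suc v) f<g = ℕ.+-mono-≤-< (f≤g zero) (sum-mono-< (f≤g ∘ suc) v f<g)

sum-+-≤ : ∀ {n} {f g h : Fin n → ℕ} → (∀ u → f u ℕ.+ g u ℕ.≤ h u) →
          sum f ℕ.+ sum g ℕ.≤ sum h
sum-+-≤ {f = f} {g} f+g≤h =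
  ℕ.≤-trans (ℕ.≤-reflexive (sym (∑-distrib-+ f g))) (sum-mono f+g≤h)

sum-≤-+ : ∀ {n} {f g h : Fin n → ℕ} → (∀ u → h u ℕ.≤ f u ℕ.+ g u) →
          sum h ℕ.≤ sum f ℕ.+ sum g
sum-≤-+ {f = f} {g} h≤f+g =
  ℕ.≤-trans (sum-mono h≤f+g) (ℕ.≤-reflexive (∑-distrib-+ f g))

sum-cover : ∀ {n} {A B C : Fin n → Set}
  (a? : ∀ u → Dec (A u)) (b? : ∀ u → Dec (B u)) (c? : ∀ u → Dec (C u)) →
  (∀ u → C u → A u ⊎ B u) →
  sum (λ u → ⟦ c? u ⟧) ℕ.≤ sum (λ u → ⟦ a? u ⟧) ℕ.+ sum (λ u → ⟦ b? u ⟧)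
sum-cover a? b? c? f = sum-≤-+ λ u → ⟦⟧-cover (a? u) (b? u) (c? u) (f u)

sum-disjoint : ∀ {n} {A B C : Fin n → Set}
  (a? : ∀ u → Dec (A u)) (b? : ∀ u → Dec (B u)) (c? : ∀ u → Dec (C u)) →
  (∀ u → A u → C u) → (∀ u → B u → C u) → (∀ u → A u → ¬ B u) →
  sum (λ u → ⟦ a? u ⟧) ℕ.+ sum (λ u → ⟦ b? u ⟧) ℕ.≤ sum (λ u → ⟦ c? u ⟧)
sum-disjoint a? b? c? f g h =
  sum-+-≤ λ u → ⟦⟧-disjoint (a? u) (b? u) (c? u) (f u) (g u) (h u)

sum-*ˡ : ∀ {n} k (f : Fin n → ℕ) → sum (λ u → k ℕ.* f u) ≡ k ℕ.* sum f
sum-*ˡ {zero}  k f = sym (ℕ.*-zeroʳ k)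
sum-*ˡ {suc n} k f =
  trans (cong (k ℕ.* f zero ℕ.+_) (sum-*ˡ k (f ∘ suc))) (sym (ℕ.*-distribˡ-+ k _ _))

sum-point : ∀ {n} (v : Fin n) → sum (λ u → ⟦ u Fin.≟ v ⟧) ≡ 1
sum-point {suc n} zero    = cong suc (sum-zero n)
  where
  sum-zero : ∀ n → sum {n} (λ _ → 0) ≡ 0
  sum-zero zero    = refl
  sum-zero (suc n) = sum-zero n
sum-point {suc n} (suc v) = sum-point v

∣∣≡sum : ∀ {n} (S : Subset n) → ∣ S ∣ ≡ sum (λ u → ⟦ u ∈? S ⟧)
∣∣≡sum []            = refl
∣∣≡sum (inside  ∷ S) = cong suc (∣∣≡sum S)
∣∣≡sum (outside ∷ S) = ∣∣≡sum S

-- Maximisation over subsets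

-- Either no subset has the decidable property P, or some subset with P
-- maximises w among those.
argmax : ∀ {n} {P : Subset n → Set} → (∀ S → Dec (P S)) → (w : Subset n → ℕ) →
         (∀ S → ¬ P S) ⊎ ∃ λ S → P S × (∀ R → P R → w R ℕ.≤ w S)
argmax {zero} P? w with P? []
... | yes p = inj₂ ([] , p , λ { [] _ → ℕ.≤-refl })
... | no ¬p = inj₁ λ { [] → ¬p }
argmax {suc n} P? w
  with argmax (λ S → P? (inside ∷ S)) (λ S → w (inside ∷ S))
     | argmax (λ S → P? (outside ∷ S)) (λ S → w (outside ∷ S))
... | inj₁ ¬i | inj₁ ¬o = inj₁ λ { (inside ∷ S) → ¬i S ; (outside ∷ S) → ¬o S }
... | inj₂ (S , p , m) | inj₁ ¬o = inj₂ (inside ∷ S , p ,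
      λ { (inside ∷ R) q → m R q ; (outside ∷ R) q → contradiction q (¬o R) })
... | inj₁ ¬i | inj₂ (S , p , m) = inj₂ (outside ∷ S , p ,
      λ { (inside ∷ R) q → contradiction q (¬i R) ; (outside ∷ R) q → m R q })
... | inj₂ (S , p , m) | inj₂ (S′ , p′ , m′) with ℕ.≤-total (w (inside ∷ S)) (w (outside ∷ S′))
...   | inj₁ ≤′ = inj₂ (outside ∷ S′ , p′ ,
        λ { (inside ∷ R) q → ℕ.≤-trans (m R q) ≤′ ; (outside ∷ R) q → m′ R q })
...   | inj₂ ′≤ = inj₂ (inside ∷ S , p ,
        λ { (inside ∷ R) q → m R q ; (outside ∷ R) q → ℕ.≤-trans (m′ R q) ′≤ })

-- Quasi-kernels and their weights

module _ (D : Digraph) where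
  open Digraph D using (arc?)

  quasiKernel? : ∀ Q → Dec (QuasiKernel D Q)
  quasiKernel? Q =
    (Fin.all? λ u → Fin.all? λ v → (u ∈? Q) →-dec ((v ∈? Q) →-dec ¬? (arc? u v)))
    ×-dec (Fin.all? λ u → ≤∞-dec ℕ._≤?_ (distTo D u Q) [ 2 ])

  -- Twice the quantity ∣Q∣/2 + ∣N⁻(Q)∣, to stay within ℕ.
  weight : Subset (order D) → ℕ
  weight Q = ∣ Q ∣ ℕ.+ 2 ℕ.* ∣ N⁻ D Q ∣

  ∣N⁻[]∣ : ∀ Q → ∣ N⁻[_] D Q ∣ ≡ ∣ Q ∣ ℕ.+ ∣ N⁻ D Q ∣
  ∣N⁻[]∣ Q rewrite ∣∣≡sum Q | ∣∣≡sum (N⁻ D Q) | ∣∣≡sum (N⁻[_] D Q) = ℕ.≤-antisym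
    (sum-cover (_∈? Q) (_∈? N⁻ D Q) (_∈? N⁻[_] D Q) (λ _ → split))
    (sum-disjoint (_∈? Q) (_∈? N⁻ D Q) (_∈? N⁻[_] D Q)
      (λ _ → ∈N⁻[]⁺ D ∘ inj₁) (λ _ → ∈N⁻[]⁺ D ∘ inj₂ ∘ proj₂ ∘ ∈N⁻⁻ D)
      (λ _ u∈Q u∈N → proj₁ (∈N⁻⁻ D u∈N) u∈Q))
    where
    split : ∀ {u} → u ∈ N⁻[_] D Q → u ∈ Q ⊎ u ∈ N⁻ D Q
    split {u} u∈ with u ∈? Q | ∈N⁻[]⁻ D u∈
    ... | yes u∈Q | _                     = inj₁ u∈Q
    ... | no _    | inj₁ u∈Q              = inj₁ u∈Q
    ... | no u∉Q  | inj₂ (v , a , v∈Q)    = inj₂ (∈N⁻⁺ D u∉Q a v∈Q)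

-- Blowing up every vertex into a directed 3-cycle

-- The arcs of the directed 3-cycle run from i to next i.
next : Fin 3 → Fin 3
next 0F = 1F
next 1F = 2F
next 2F = 0F

next-≢ : ∀ i → i ≢ next i
next-≢ 0F ()
next-≢ 1F ()
next-≢ 2F ()

next-total : ∀ i j → i ≡ j ⊎ (j ≡ next i ⊎ i ≡ next j)
next-total = from-yes (Fin.all? λ i → Fin.all? λ j →
  (i Fin.≟ j) ⊎-dec ((j Fin.≟ next i) ⊎-dec (i Fin.≟ next j)))

sum-point-next : ∀ i → sum (λ j → ⟦ next j Fin.≟ i ⟧) ≡ 1
sum-point-next 0F = refl
sum-point-next 1F = refl
sum-point-next 2F = refl

-- A sum over the blown-up vertices, grouped by 3-cycle.
sum-triples : ∀ n (f : Fin (n ℕ.* 3) → ℕ) →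
              sum f ≡ sum {n} (λ u → sum {3} (λ i → f (combine u i)))
sum-triples zero    f = refl
sum-triples (suc n) f = begin
  a ℕ.+ (b ℕ.+ (c ℕ.+ rest))              ≡⟨ regroup a b c rest ⟩
  (a ℕ.+ (b ℕ.+ (c ℕ.+ 0))) ℕ.+ rest      ≡⟨ cong (a ℕ.+ (b ℕ.+ (c ℕ.+ 0)) ℕ.+_)
                                                  (sum-triples n (λ x → f (suc (suc (suc x))))) ⟩
  (a ℕ.+ (b ℕ.+ (c ℕ.+ 0))) ℕ.+ sum {n} (λ u → sum {3} (λ i → f (combine (suc u) i))) ∎
  where
  open ≡-Reasoning
  a = f 0F
  b = f 1F
  c = f 2F
  rest = sum (λ x → f (suc (suc (suc x))))
  regroup : ∀ a b c d → a ℕ.+ (b ℕ.+ (c ℕ.+ d)) ≡ (a ℕ.+ (b ℕ.+ (c ℕ.+ 0))) ℕ.+ d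
  regroup = ℕ-Ring.solve-∀

module BlowUp (D : Digraph) where
  open Digraph D using (Vertex; Arc; arc?; loopless)

  -- The vertex of D that a blown-up vertex lies over.
  base : Fin (order D ℕ.* 3) → Vertex
  base = quotient 3

  -- The position of a blown-up vertex in its 3-cycle.
  phase : Fin (order D ℕ.* 3) → Fin 3
  phase = remainder {order D} 3

  -- The lexicographic product D[C₃]: each vertex becomes a directed
  -- 3-cycle, and each arc becomes all nine arcs between two such cycles.
  blowUp : Digraph
  blowUp = record
    { order    = order D ℕ.* 3
    ; Arc      = λ x y → Arc (base x) (base y) ⊎ (base x ≡ base y × phase y ≡ next (phase x))
    ; arc?     = λ x y → arc? (base x) (base y) ⊎-dec
                         ((base x Fin.≟ base y) ×-dec (phase y Fin.≟ next (phase x)))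
    ; loopless = λ { refl → [ loopless refl , (λ (_ , p) → next-≢ _ p) ]′ }
    }

  open Digraph blowUp using () renaming (Vertex to Vertex⁺; Arc to Arc⁺)

  -- The vertex at position i of the 3-cycle over u.
  copy : Vertex → Fin 3 → Vertex⁺
  copy = combine

  base-copy : ∀ u i → base (copy u i) ≡ u
  base-copy u i = cong proj₁ (Fin.remQuot-combine u i)

  phase-copy : ∀ u i → phase (copy u i) ≡ i
  phase-copy u i = cong proj₂ (Fin.remQuot-combine u i)

  copy-base : ∀ x → copy (base x) (phase x) ≡ x
  copy-base = Fin.combine-remQuot {order D} 3

  arc-lift : ∀ {u v} i j → Arc u v → Arc⁺ (copy u i) (copy v j)
  arc-lift i j a = inj₁ (subst₂ Arc (sym (base-copy _ i)) (sym (base-copy _ j)) a)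

  arc-next : ∀ u {i j} → j ≡ next i → Arc⁺ (copy u i) (copy u j)
  arc-next u {i} {j} j≡ = inj₂ (trans (base-copy u i) (sym (base-copy u j)) ,
    trans (phase-copy u j) (trans j≡ (cong next (sym (phase-copy u i)))))

  arc-descend : ∀ {u v i j} → Arc⁺ (copy u i) (copy v j) → Arc u v ⊎ (u ≡ v × j ≡ next i)
  arc-descend {u} {v} {i} {j}
    rewrite base-copy u i | base-copy v j | phase-copy u i | phase-copy v j = id

  sinkFree : SinkFree blowUp
  sinkFree x sink = sink (copy (base x) (next (phase x)))
    (subst (λ z → Arc⁺ z (copy (base x) (next (phase x)))) (copy-base x) (arc-next (base x) refl))

  module _ (Q⁺ : Subset (order blowUp)) where

    meets? : ∀ u → Dec (∃ λ i → copy u i ∈ Q⁺)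
    meets? u = Fin.any? λ i → copy u i ∈? Q⁺

    -- The vertices whose 3-cycle meets Q⁺.
    shadow : Subset (order D)
    shadow = subset meets?

    base∈shadow : ∀ {x} → x ∈ Q⁺ → base x ∈ shadow
    base∈shadow {x} x∈ = ∈-subset⁺ meets? (phase x , subst (_∈ Q⁺) (sym (copy-base x)) x∈)

    copy∈⇒∈shadow : ∀ {u i} → copy u i ∈ Q⁺ → u ∈ shadow
    copy∈⇒∈shadow {i = i} c∈ = ∈-subset⁺ meets? (i , c∈)

    -- Arcs inside a 3-cycle project to a single vertex, so walks project to
    -- walks that are no longer.
    ⇝-shadow : ∀ k {x} → _⇝[_]_ blowUp x k Q⁺ → _⇝[_]_ D (base x) k shadow
    ⇝-shadow zero    x∈ = base∈shadow x∈
    ⇝-shadow (suc k) (inj₁ w) = inj₁ (⇝-shadow k w)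
    ⇝-shadow (suc k) (inj₂ (y , inj₁ a , w)) = inj₂ (base y , a , ⇝-shadow k w)
    ⇝-shadow (suc k) (inj₂ (y , inj₂ (bx≡by , _) , w)) =
      inj₁ (subst (λ b → _⇝[_]_ D b k shadow) (sym bx≡by) (⇝-shadow k w))

    module _ (indep : Independent blowUp Q⁺) where

      shadow-independent : Independent D shadow
      shadow-independent u v u∈ v∈ a
        with i , ui∈ ← ∈-subset⁻ meets? u∈
        with j , vj∈ ← ∈-subset⁻ meets? v∈
        = indep _ _ ui∈ vj∈ (arc-lift i j a)

      -- Any two vertices of a 3-cycle are adjacent.
      copy-unique : ∀ {u i j} → copy u i ∈ Q⁺ → copy u j ∈ Q⁺ → i ≡ j
      copy-unique {u} {i} {j} i∈ j∈ with next-total i j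
      ... | inj₁ i≡j        = i≡j
      ... | inj₂ (inj₁ j≡i⁺) = contradiction (arc-next u j≡i⁺) (indep _ _ i∈ j∈)
      ... | inj₂ (inj₂ i≡j⁺) = contradiction (arc-next u i≡j⁺) (indep _ _ j∈ i∈)

      ∣Q⁺∣≤ : ∣ Q⁺ ∣ ℕ.≤ ∣ shadow ∣
      ∣Q⁺∣≤ rewrite ∣∣≡sum Q⁺ | ∣∣≡sum shadow | sum-triples (order D) (λ x → ⟦ x ∈? Q⁺ ⟧) =
        sum-mono λ u → in-cycle u (u ∈? shadow)
        where
        in-cycle : ∀ u (u∈? : Dec (u ∈ shadow)) →
                   sum (λ i → ⟦ copy u i ∈? Q⁺ ⟧) ℕ.≤ ⟦ u∈? ⟧
        in-cycle u (no u∉) = sum-mono {3} {g = const 0} λ i →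
          ⟦⟧-mono (copy u i ∈? Q⁺) (no id) (u∉ ∘ copy∈⇒∈shadow)
        in-cycle u (yes u∈) with j , uj∈ ← ∈-subset⁻ meets? u∈ =
          ℕ.≤-trans
            (sum-mono {3} λ i → ⟦⟧-mono (copy u i ∈? Q⁺) (i Fin.≟ j) (λ ui∈ → copy-unique ui∈ uj∈))
            (ℕ.≤-reflexive (sum-point j))

      -- Over a vertex of the shadow, only the predecessor of the vertex in
      -- Q⁺ can lie in N⁻(Q⁺), since the shadow is independent. Over any other
      -- vertex, all three may, provided that the vertex lies in N⁻(shadow).
      ∣N⁻Q⁺∣≤ : ∣ N⁻ blowUp Q⁺ ∣ ℕ.≤ ∣ shadow ∣ ℕ.+ 3 ℕ.* ∣ N⁻ D shadow ∣
      ∣N⁻Q⁺∣≤ rewrite ∣∣≡sum (N⁻ blowUp Q⁺) | ∣∣≡sum shadow | ∣∣≡sum (N⁻ D shadow)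
                    | sum-triples (order D) (λ x → ⟦ x ∈? N⁻ blowUp Q⁺ ⟧)
                    | sym (sum-*ˡ 3 (λ u → ⟦ u ∈? N⁻ D shadow ⟧)) =
        sum-≤-+ λ u → in-cycle u (u ∈? shadow)
        where
        -- The arc from copy u i into Q⁺ leaves its 3-cycle or stays in it.
        out-neighbour : ∀ {u i} → copy u i ∈ N⁻ blowUp Q⁺ →
          (∃ λ v → Arc u v × v ∈ shadow) ⊎ copy u (next i) ∈ Q⁺
        out-neighbour {u} {i} c∈ =
          let _ , y , a , y∈ = ∈N⁻⁻ blowUp c∈ in
          Sum.map
            (λ uv → base y , uv , base∈shadow y∈)
            (λ (u≡ , p≡) → subst (_∈ Q⁺) (trans (sym (copy-base y)) (cong₂ copy (sym u≡) p≡)) y∈)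
            (arc-descend {u} {base y} {i} {phase y}
              (subst (Arc⁺ (copy u i)) (sym (copy-base y)) a))

        in-cycle : ∀ u (u∈? : Dec (u ∈ shadow)) →
          sum (λ i → ⟦ copy u i ∈? N⁻ blowUp Q⁺ ⟧) ℕ.≤
          ⟦ u∈? ⟧ ℕ.+ 3 ℕ.* ⟦ u ∈? N⁻ D shadow ⟧
        in-cycle u (no u∉) = sum-mono {3} {g = const _} λ i →
          ⟦⟧-mono (copy u i ∈? N⁻ blowUp Q⁺) (u ∈? N⁻ D shadow) λ c∈ →
            case out-neighbour {u} {i} c∈ of λ where
              (inj₁ (v , a , v∈)) → ∈N⁻⁺ D u∉ a v∈
              (inj₂ c⁺∈)          → contradiction (copy∈⇒∈shadow c⁺∈) u∉
        in-cycle u (yes u∈) with j , uj∈ ← ∈-subset⁻ meets? u∈ =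
          ℕ.≤-trans
            (sum-mono {3} λ i → ⟦⟧-mono (copy u i ∈? N⁻ blowUp Q⁺) (next i Fin.≟ j) λ c∈ →
              case out-neighbour {u} {i} c∈ of λ where
                (inj₁ (v , a , v∈)) → contradiction a (shadow-independent u v u∈ v∈)
                (inj₂ c⁺∈)          → copy-unique c⁺∈ uj∈)
            (ℕ.≤-trans (ℕ.≤-reflexive (sum-point-next j)) (ℕ.m≤m+n 1 _))

      -- The 3-cycle over a vertex of the shadow contributes at most 1 to
      -- Q⁺ and 1 to N⁻(Q⁺), hence weight 1 + 2 = 3 in place of weight 1.
      weight≤ : weight blowUp Q⁺ ℕ.≤ 3 ℕ.* weight D shadow
      weight≤ = ℕ.≤-trans
        (ℕ.+-mono-≤ ∣Q⁺∣≤ (ℕ.*-monoʳ-≤ 2 ∣N⁻Q⁺∣≤))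
        (ℕ.≤-reflexive (regroup ∣ shadow ∣ ∣ N⁻ D shadow ∣))
        where
        regroup : ∀ q p → q ℕ.+ 2 ℕ.* (q ℕ.+ 3 ℕ.* p) ≡ 3 ℕ.* (q ℕ.+ 2 ℕ.* p)
        regroup = ℕ-Ring.solve-∀

    shadow-quasiKernel : QuasiKernel blowUp Q⁺ → QuasiKernel D shadow
    shadow-quasiKernel (indep , near) = shadow-independent indep , λ u →
      ⇝⇒distTo₂ D (subst (λ b → _⇝[_]_ D b 2 shadow) (base-copy u 0F)
        (⇝-shadow 2 (distTo⇒⇝ blowUp 2 (near (copy u 0F)))))

open BlowUp using (blowUp; shadow; shadow-quasiKernel)

-- The k-fold iterated blow-up.
tower : ℕ → Digraph → Digraph
tower zero    D = D
tower (suc k) D = blowUp (tower k D)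

order-tower : ∀ k D → order (tower k D) ≡ order D ℕ.* 3 ℕ.^ k
order-tower zero    D = sym (ℕ.*-identityʳ _)
order-tower (suc k) D rewrite order-tower k D =
  trans (ℕ.*-assoc (order D) (3 ℕ.^ k) 3) (cong (order D ℕ.*_) (ℕ.*-comm (3 ℕ.^ k) 3))

tower-shadow : ∀ k D Q⁺ → QuasiKernel (tower k D) Q⁺ → ∃ λ Q → QuasiKernel D Q ×
  ∣ Q⁺ ∣ ℕ.≤ ∣ Q ∣ × weight (tower k D) Q⁺ ℕ.≤ 3 ℕ.^ k ℕ.* weight D Q
tower-shadow zero    D Q⁺ qk = Q⁺ , qk , ℕ.≤-refl , ℕ.≤-reflexive (sym (ℕ.*-identityˡ _))
tower-shadow (suc k) D Q⁺ qk =
  let E               = tower k D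
      S               = shadow E Q⁺
      Q , qkQ , c , w = tower-shadow k D S (shadow-quasiKernel E Q⁺ qk)
  in Q , qkQ , ℕ.≤-trans (BlowUp.∣Q⁺∣≤ E Q⁺ (proj₁ qk)) c , (begin
    weight (blowUp E) Q⁺                   ≤⟨ BlowUp.weight≤ E Q⁺ (proj₁ qk) ⟩
    3 ℕ.* weight E S                       ≤⟨ ℕ.*-monoʳ-≤ 3 w ⟩
    3 ℕ.* (3 ℕ.^ k ℕ.* weight D Q)         ≡⟨ ℕ.*-assoc 3 (3 ℕ.^ k) (weight D Q) ⟨
    3 ℕ.^ suc k ℕ.* weight D Q             ∎)
  where open ℕ.≤-Reasoning

-- Independent sets of large weight

module _ (D : Digraph) where
  open Digraph D using (Vertex; Arc; arc?; loopless)

  module _ (S : Subset (order D)) where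

    arcIn? : ∀ u v → Dec (u ∈ S × v ∈ S × Arc u v)
    arcIn? u v = (u ∈? S) ×-dec (v ∈? S) ×-dec arc? u v

    -- Degrees in the subdigraph induced on S.
    outdeg indeg : Vertex → ℕ
    outdeg v = sum λ u → ⟦ arcIn? v u ⟧
    indeg  v = sum λ u → ⟦ arcIn? u v ⟧

    -- Both degrees sum to the number of arcs inside S, so the in-degree cannot
    -- be the smaller one at every vertex of S.
    ∃-outdeg≤indeg : Nonempty S → ∃ λ v → v ∈ S × outdeg v ℕ.≤ indeg v
    ∃-outdeg≤indeg (x , x∈S) with Fin.any? (λ v → (v ∈? S) ×-dec (outdeg v ℕ.≤? indeg v))
    ... | yes found = found
    ... | no ¬found = contradiction (∑-comm λ u v → ⟦ arcIn? u v ⟧)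
      (λ eq → ℕ.<-irrefl (sym eq) (sum-mono-< indeg≤outdeg x (in<out x∈S)))
      where
      in<out : ∀ {v} → v ∈ S → indeg v ℕ.< outdeg v
      in<out v∈S = ℕ.≰⇒> λ out≤in → ¬found (_ , v∈S , out≤in)
      indeg≤outdeg : ∀ v → indeg v ℕ.≤ outdeg v
      indeg≤outdeg v = case v ∈? S of λ where
        (yes v∈S) → ℕ.<⇒≤ (in<out v∈S)
        (no  v∉S) → sum-mono λ u → ⟦⟧-mono (arcIn? u v) (arcIn? v u)
                      λ (_ , v∈S , _) → contradiction v∈S v∉S

  module _ (S : Subset (order D)) (v : Vertex) where

    apart? : ∀ u → Dec (u ∈ S × u ≢ v × ¬ Arc u v × ¬ Arc v u)
    apart? u = (u ∈? S) ×-dec ¬? (u Fin.≟ v) ×-dec ¬? (arc? u v) ×-dec ¬? (arc? v u)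

    -- S without v and its in- and out-neighbours.
    apart : Subset (order D)
    apart = subset apart?

    ∣S∣≤ : v ∈ S → ∣ S ∣ ℕ.≤ 1 ℕ.+ (indeg S v ℕ.+ (outdeg S v ℕ.+ ∣ apart ∣))
    ∣S∣≤ v∈S rewrite ∣∣≡sum S | ∣∣≡sum apart = begin
      sum (λ u → ⟦ u ∈? S ⟧)
        ≤⟨ sum-cover (Fin._≟ v) rest₁? (_∈? S) split ⟩
      sum (λ u → ⟦ u Fin.≟ v ⟧) ℕ.+ sum (λ u → ⟦ rest₁? u ⟧)
        ≡⟨ cong (ℕ._+ sum (λ u → ⟦ rest₁? u ⟧)) (sum-point v) ⟩
      1 ℕ.+ sum (λ u → ⟦ rest₁? u ⟧)
        ≤⟨ ℕ.+-monoʳ-≤ 1 (sum-cover (λ u → arcIn? S u v) rest₂? rest₁? (λ _ → id)) ⟩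
      1 ℕ.+ (indeg S v ℕ.+ sum (λ u → ⟦ rest₂? u ⟧))
        ≤⟨ ℕ.+-monoʳ-≤ 1 (ℕ.+-monoʳ-≤ (indeg S v)
             (sum-cover (arcIn? S v) (_∈? apart) rest₂? (λ _ → id))) ⟩
      1 ℕ.+ (indeg S v ℕ.+ (outdeg S v ℕ.+ sum (λ u → ⟦ u ∈? apart ⟧))) ∎
      where
      open ℕ.≤-Reasoning
      rest₂? : ∀ u → Dec ((v ∈ S × u ∈ S × Arc v u) ⊎ u ∈ apart)
      rest₂? u = arcIn? S v u ⊎-dec (u ∈? apart)
      rest₁? : ∀ u → Dec ((u ∈ S × v ∈ S × Arc u v) ⊎ ((v ∈ S × u ∈ S × Arc v u) ⊎ u ∈ apart))
      rest₁? u = arcIn? S u v ⊎-dec rest₂? u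
      split : ∀ u → u ∈ S →
        u ≡ v ⊎ ((u ∈ S × v ∈ S × Arc u v) ⊎ ((v ∈ S × u ∈ S × Arc v u) ⊎ u ∈ apart))
      split u u∈S = case u Fin.≟ v of λ where
        (yes u≡v) → inj₁ u≡v
        (no u≢v)  → inj₂ (case arc? u v of λ where
          (yes uv) → inj₁ (u∈S , v∈S , uv)
          (no ¬uv) → inj₂ (case arc? v u of λ where
            (yes vu) → inj₁ (v∈S , u∈S , vu)
            (no ¬vu) → inj₂ (∈-subset⁺ apart? (u∈S , u≢v , ¬uv , ¬vu))))

    apart⊂ : v ∈ S → apart ⊂ S
    apart⊂ v∈S = proj₁ ∘ ∈-subset⁻ apart? ,
      v , v∈S , λ v∈ → proj₁ (proj₂ (∈-subset⁻ apart? v∈)) refl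

    -- The effect of adding v to a subset I of what is left.
    module _ (I : Subset (order D)) (I⊆ : I ⊆ apart) where

      private
        not-v : ∀ {u} → u ∈ apart → u ∉ ⁅ v ⁆
        not-v u∈ u∈v = proj₁ (proj₂ (∈-subset⁻ apart? u∈)) (x∈⁅y⁆⇒x≡y v u∈v)

      insert-independent : Independent D I → Independent D (⁅ v ⁆ ∪ I)
      insert-independent indep x y x∈ y∈ xy with x∈p∪q⁻ ⁅ v ⁆ I x∈ | x∈p∪q⁻ ⁅ v ⁆ I y∈
      ... | inj₂ x∈I | inj₂ y∈I = indep x y x∈I y∈I xy
      ... | inj₁ x∈v | inj₁ y∈v =
        loopless (trans (x∈⁅y⁆⇒x≡y v x∈v) (sym (x∈⁅y⁆⇒x≡y v y∈v))) xy
      ... | inj₁ x∈v | inj₂ y∈I with refl ← x∈⁅y⁆⇒x≡y v x∈v =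
        proj₂ (proj₂ (proj₂ (∈-subset⁻ apart? (I⊆ y∈I)))) xy
      ... | inj₂ x∈I | inj₁ y∈v with refl ← x∈⁅y⁆⇒x≡y v y∈v =
        proj₁ (proj₂ (proj₂ (∈-subset⁻ apart? (I⊆ x∈I)))) xy

      insert-⊆ : v ∈ S → ⁅ v ⁆ ∪ I ⊆ S
      insert-⊆ v∈S u∈ with x∈p∪q⁻ ⁅ v ⁆ I u∈
      ... | inj₁ u∈v with refl ← x∈⁅y⁆⇒x≡y v u∈v = v∈S
      ... | inj₂ u∈I = proj₁ (∈-subset⁻ apart? (I⊆ u∈I))

      insert-∣∣ : 1 ℕ.+ ∣ I ∣ ℕ.≤ ∣ ⁅ v ⁆ ∪ I ∣
      insert-∣∣ rewrite ∣∣≡sum I | ∣∣≡sum (⁅ v ⁆ ∪ I) =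
        subst (λ k → k ℕ.+ sum (λ u → ⟦ u ∈? I ⟧) ℕ.≤ sum (λ u → ⟦ u ∈? (⁅ v ⁆ ∪ I) ⟧))
          (sum-point v)
          (sum-disjoint (Fin._≟ v) (_∈? I) (_∈? (⁅ v ⁆ ∪ I))
            (λ { u refl → x∈p∪q⁺ (inj₁ (x∈⁅x⁆ v)) })
            (λ u u∈I → x∈p∪q⁺ (inj₂ u∈I))
            (λ { u refl u∈I → not-v (I⊆ u∈I) (x∈⁅x⁆ v) }))

      insert-N⁻ : indeg S v ℕ.+ ∣ apart ∩ N⁻ D I ∣ ℕ.≤ ∣ S ∩ N⁻ D (⁅ v ⁆ ∪ I) ∣
      insert-N⁻ rewrite ∣∣≡sum (apart ∩ N⁻ D I) | ∣∣≡sum (S ∩ N⁻ D (⁅ v ⁆ ∪ I)) =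
        sum-disjoint (λ u → arcIn? S u v) (_∈? (apart ∩ N⁻ D I)) (_∈? (S ∩ N⁻ D (⁅ v ⁆ ∪ I)))
          (λ u (u∈S , _ , uv) → x∈p∩q⁺ (u∈S , ∈N⁻⁺ D (u∉⁺ uv) uv (x∈p∪q⁺ (inj₁ (x∈⁅x⁆ v)))))
          from-apart
          (λ u (_ , _ , uv) u∈ → no-arc (proj₁ (x∈p∩q⁻ apart _ u∈)) uv)
        where
        no-arc : ∀ {u} → u ∈ apart → ¬ Arc u v
        no-arc u∈ = proj₁ (proj₂ (proj₂ (∈-subset⁻ apart? u∈)))
        u∉⁺ : ∀ {u} → Arc u v → u ∉ ⁅ v ⁆ ∪ I
        u∉⁺ uv u∈ with x∈p∪q⁻ ⁅ v ⁆ I u∈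
        ... | inj₁ u∈v = loopless (x∈⁅y⁆⇒x≡y v u∈v) uv
        ... | inj₂ u∈I = no-arc (I⊆ u∈I) uv
        from-apart : ∀ u → u ∈ apart ∩ N⁻ D I → u ∈ S ∩ N⁻ D (⁅ v ⁆ ∪ I)
        from-apart u u∈ =
          let u∈a , u∈N          = x∈p∩q⁻ apart (N⁻ D I) u∈
              u∉I , w , uw , w∈I = ∈N⁻⁻ D u∈N
          in x∈p∩q⁺ (proj₁ (∈-subset⁻ apart? u∈a) ,
               ∈N⁻⁺ D ([ not-v u∈a , u∉I ]′ ∘ x∈p∪q⁻ ⁅ v ⁆ I) uw (x∈p∪q⁺ (inj₂ w∈I)))

  -- Counting N⁻(I) only inside S keeps the in-neighbours found at different
  -- stages of the recursion disjoint.
  large-independent : ∀ S → Acc _⊂_ S → ∃ λ I → I ⊆ S × Independent D I ×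
                      ∣ S ∣ ℕ.≤ ∣ I ∣ ℕ.+ 2 ℕ.* ∣ S ∩ N⁻ D I ∣
  large-independent S (acc rec) with nonempty? S
  ... | no empty = S , id , (λ u _ u∈S _ _ → empty (u , u∈S)) , ℕ.m≤m+n ∣ S ∣ _
  ... | yes ne
    with v , v∈S , out≤in ← ∃-outdeg≤indeg S ne
    with I , I⊆ , indep , large ← large-independent (apart S v) (rec (apart⊂ S v v∈S))
    = ⁅ v ⁆ ∪ I , insert-⊆ S v I I⊆ v∈S , insert-independent S v I I⊆ indep , (begin
      ∣ S ∣
        ≤⟨ ∣S∣≤ S v v∈S ⟩
      1 ℕ.+ (i ℕ.+ (outdeg S v ℕ.+ ∣ apart S v ∣))
        ≤⟨ ℕ.+-monoʳ-≤ 1 (ℕ.+-monoʳ-≤ i (ℕ.+-mono-≤ out≤in large)) ⟩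
      1 ℕ.+ (i ℕ.+ (i ℕ.+ (∣ I ∣ ℕ.+ 2 ℕ.* p)))
        ≡⟨ regroup i ∣ I ∣ p ⟩
      (1 ℕ.+ ∣ I ∣) ℕ.+ 2 ℕ.* (i ℕ.+ p)
        ≤⟨ ℕ.+-mono-≤ (insert-∣∣ S v I I⊆) (ℕ.*-monoʳ-≤ 2 (insert-N⁻ S v I I⊆)) ⟩
      ∣ ⁅ v ⁆ ∪ I ∣ ℕ.+ 2 ℕ.* ∣ S ∩ N⁻ D (⁅ v ⁆ ∪ I) ∣ ∎)
    where
    open ℕ.≤-Reasoning
    i = indeg S v
    p = ∣ apart S v ∩ N⁻ D I ∣
    regroup : ∀ i c p → 1 ℕ.+ (i ℕ.+ (i ℕ.+ (c ℕ.+ 2 ℕ.* p))) ≡ (1 ℕ.+ c) ℕ.+ 2 ℕ.* (i ℕ.+ p)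
    regroup = ℕ-Ring.solve-∀

  independent-weight≥order : ∃ λ I → Independent D I × order D ℕ.≤ weight D I
  independent-weight≥order with I , _ , indep , large ← large-independent ⊤ (⊂-wellFounded ⊤) =
    I , indep , (begin
      order D                                ≡⟨ ∣⊤∣≡n (order D) ⟨
      ∣ ⊤ {order D} ∣                        ≤⟨ large ⟩
      ∣ I ∣ ℕ.+ 2 ℕ.* ∣ ⊤ ∩ N⁻ D I ∣
        ≤⟨ ℕ.+-monoʳ-≤ ∣ I ∣ (ℕ.*-monoʳ-≤ 2 (∣p∩q∣≤∣q∣ ⊤ (N⁻ D I))) ⟩
      weight D I                             ∎)
    where open ℕ.≤-Reasoning

-- Natural numbers as rationals

fromℚᵘ-homo-+ : ∀ p q → ℚ.fromℚᵘ (p ℚᵘ.+ q) ≡ ℚ.fromℚᵘ p + ℚ.fromℚᵘ q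
fromℚᵘ-homo-+ p q = ℚ.toℚᵘ-injective (ℚᵘ.≃-trans (ℚ.toℚᵘ-fromℚᵘ (p ℚᵘ.+ q))
  (ℚᵘ.≃-sym (ℚᵘ.≃-trans (ℚ.toℚᵘ-homo-+ (ℚ.fromℚᵘ p) (ℚ.fromℚᵘ q))
    (ℚᵘ.+-cong (ℚ.toℚᵘ-fromℚᵘ p) (ℚ.toℚᵘ-fromℚᵘ q)))))

fromℚᵘ-homo-* : ∀ p q → ℚ.fromℚᵘ (p ℚᵘ.* q) ≡ ℚ.fromℚᵘ p * ℚ.fromℚᵘ q
fromℚᵘ-homo-* p q = ℚ.toℚᵘ-injective (ℚᵘ.≃-trans (ℚ.toℚᵘ-fromℚᵘ (p ℚᵘ.* q))
  (ℚᵘ.≃-sym (ℚᵘ.≃-trans (ℚ.toℚᵘ-homo-* (ℚ.fromℚᵘ p) (ℚ.fromℚᵘ q))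
    (ℚᵘ.*-cong (ℚ.toℚᵘ-fromℚᵘ p) (ℚ.toℚᵘ-fromℚᵘ q)))))

fromℚᵘ-mono-≤ : ∀ {p q} → p ℚᵘ.≤ q → ℚ.fromℚᵘ p ≤ ℚ.fromℚᵘ q
fromℚᵘ-mono-≤ {p} {q} p≤q = ℚ.toℚᵘ-cancel-≤
  (ℚᵘ.≤-respˡ-≃ (ℚᵘ.≃-sym (ℚ.toℚᵘ-fromℚᵘ p)) (ℚᵘ.≤-respʳ-≃ (ℚᵘ.≃-sym (ℚ.toℚᵘ-fromℚᵘ q)) p≤q))

fromℕ-homo-+ : ∀ m n → fromℕ (m ℕ.+ n) ≡ fromℕ m + fromℕ n
fromℕ-homo-+ m n = trans
  (ℚ.fromℚᵘ-cong {mkℚᵘ (ℤ.+ (m ℕ.+ n)) 0} {mkℚᵘ (ℤ.+ m) 0 ℚᵘ.+ mkℚᵘ (ℤ.+ n) 0}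
    (*≡* (cong (ℤ._* (ℤ.+ 1)) (sym (cong₂ ℤ._+_ (ℤ.*-identityʳ (ℤ.+ m)) (ℤ.*-identityʳ (ℤ.+ n)))))))
  (fromℚᵘ-homo-+ (mkℚᵘ (ℤ.+ m) 0) (mkℚᵘ (ℤ.+ n) 0))

fromℕ-homo-* : ∀ m n → fromℕ (m ℕ.* n) ≡ fromℕ m * fromℕ n
fromℕ-homo-* m n = trans
  (ℚ.fromℚᵘ-cong {mkℚᵘ (ℤ.+ (m ℕ.* n)) 0} {mkℚᵘ (ℤ.+ m) 0 ℚᵘ.* mkℚᵘ (ℤ.+ n) 0}
    (*≡* (cong (ℤ._* (ℤ.+ 1)) (ℤ.pos-* m n))))
  (fromℚᵘ-homo-* (mkℚᵘ (ℤ.+ m) 0) (mkℚᵘ (ℤ.+ n) 0))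

fromℕ-mono-≤ : ∀ {m n} → m ℕ.≤ n → fromℕ m ≤ fromℕ n
fromℕ-mono-≤ {m} {n} m≤n =
  fromℚᵘ-mono-≤ {mkℚᵘ (ℤ.+ m) 0} {mkℚᵘ (ℤ.+ n) 0} (*≤* (ℤ.*-monoʳ-≤-nonNeg (ℤ.+ 1) (ℤ.+≤+ m≤n)))

half≡ : ∀ n → half n ≡ ½ * fromℕ n
half≡ n = trans
  (ℚ.fromℚᵘ-cong {mkℚᵘ (ℤ.+ n) 1} {mkℚᵘ (ℤ.+ 1) 1 ℚᵘ.* mkℚᵘ (ℤ.+ n) 0}
    (*≡* (cong (ℤ._* (ℤ.+ 2)) (sym (ℤ.*-identityˡ (ℤ.+ n))))))
  (fromℚᵘ-homo-* (mkℚᵘ (ℤ.+ 1) 1) (mkℚᵘ (ℤ.+ n) 0))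

half-mono-≤ : ∀ {m n} → m ℕ.≤ n → half m ≤ half n
half-mono-≤ {m} {n} m≤n rewrite half≡ m | half≡ n = ℚ.*-monoˡ-≤-nonNeg ½ (fromℕ-mono-≤ m≤n)

half-+ : ∀ q p → half q + fromℕ p ≡ half (q ℕ.+ 2 ℕ.* p)
half-+ q p rewrite half≡ q | half≡ (q ℕ.+ 2 ℕ.* p) | fromℕ-homo-+ q (2 ℕ.* p) | fromℕ-homo-* 2 p =
  solve 2 (λ x y → con ½ :* x :+ y := con ½ :* (x :+ con (fromℕ 2) :* y)) refl (fromℕ q) (fromℕ p)
  where open ℚ-Ring.+-*-Solver

half≤fromℕ : ∀ n → half n ≤ fromℕ n
half≤fromℕ n = begin
  half n                     ≤⟨ half-mono-≤ (ℕ.m≤m+n n n) ⟩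
  half (n ℕ.+ n)             ≡⟨ cong (λ m → half (n ℕ.+ m)) (ℕ.+-identityʳ n) ⟨
  half (0 ℕ.+ 2 ℕ.* n)       ≡⟨ half-+ 0 n ⟨
  0ℚ + fromℕ n               ≡⟨ ℚ.+-identityˡ (fromℕ n) ⟩
  fromℕ n                    ∎
  where open ℚ.≤-Reasoning

-- As ε ≥ 1/d for its denominator d, the product n * d is large enough.
archimedean : ∀ n ε → 0ℚ < ε → ∃ λ k → fromℕ n ≤ fromℕ k * ε
archimedean n ε 0<ε = n ℕ.* d , (begin
  fromℕ n                     ≡⟨ ℚ.*-identityʳ (fromℕ n) ⟨
  fromℕ n * 1ℚ                ≤⟨ ℚ.*-monoˡ-≤-nonNeg (fromℕ n) {{n≥0}} (1≤dε ε 0<ε) ⟩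
  fromℕ n * (fromℕ d * ε)     ≡⟨ ℚ.*-assoc (fromℕ n) (fromℕ d) ε ⟨
  fromℕ n * fromℕ d * ε       ≡⟨ cong (_* ε) (fromℕ-homo-* n d) ⟨
  fromℕ (n ℕ.* d) * ε         ∎)
  where
  open ℚ.≤-Reasoning
  d = ℚ.↧ₙ ε
  n≥0 : ℚ.NonNegative (fromℕ n)
  n≥0 = ℚ.nonNegative (fromℕ-mono-≤ {0} {n} z≤n)
  1≤dε : ∀ ε → 0ℚ < ε → 1ℚ ≤ fromℕ (ℚ.↧ₙ ε) * ε
  1≤dε ε@(ℚ.mkℚ (ℤ.+ 0) d-1 _) 0<ε = contradiction (ℚ.positive 0<ε) λ ()
  1≤dε ε@(ℚ.mkℚ -[1+ n ] d-1 _) 0<ε = contradiction (ℚ.positive 0<ε) λ ()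
  1≤dε ε@(ℚ.mkℚ +[1+ m ] d-1 _) 0<ε = subst (1ℚ ≤_)
    (trans (fromℚᵘ-homo-* (mkℚᵘ (ℤ.+ suc d-1) 0) (mkℚᵘ +[1+ m ] d-1))
           (cong (fromℕ (suc d-1) *_) (ℚ.fromℚᵘ-toℚᵘ ε)))
    (fromℚᵘ-mono-≤ {mkℚᵘ (ℤ.+ 1) 0} {mkℚᵘ (ℤ.+ suc d-1) 0 ℚᵘ.* mkℚᵘ +[1+ m ] d-1}
      (*≤* (ℤ.+≤+ (ℕ.≤-trans
        (ℕ.≤-reflexive (trans (ℕ.*-identityˡ (1 ℕ.* suc d-1)) (ℕ.*-identityˡ (suc d-1))))
        (ℕ.≤-trans (ℕ.m≤m*n (suc d-1) (suc m)) (ℕ.≤-reflexive (sym (ℕ.*-identityʳ _))))))))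

-- Comparing the sink-free closed bound with the weighted bound

1+k≤3^k : ∀ k → 1 ℕ.+ k ℕ.≤ 3 ℕ.^ k
1+k≤3^k zero    = ℕ.≤-refl
1+k≤3^k (suc k) = begin
  2 ℕ.+ k                  ≤⟨ ℕ.+-mono-≤ (ℕ.≤-trans (ℕ.m≤m+n 1 k) (1+k≤3^k k)) (1+k≤3^k k) ⟩
  3 ℕ.^ k ℕ.+ 3 ℕ.^ k      ≤⟨ ℕ.+-monoʳ-≤ (3 ℕ.^ k) (ℕ.m≤m+n (3 ℕ.^ k) _) ⟩
  3 ℕ.^ suc k              ∎
  where open ℕ.≤-Reasoning

-- Iterating multiplies the weight by up to 3^k, like the number of vertices,
-- while ∣Q⁺∣, the excess of 2∣N⁻[Q⁺]∣ over the weight, stays at most n.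
tower-N⁻[] : ∀ k D Q⁺ → QuasiKernel (tower k D) Q⁺ → ∃ λ Q → QuasiKernel D Q ×
  2 ℕ.* ∣ N⁻[_] (tower k D) Q⁺ ∣ ℕ.≤ order D ℕ.+ 3 ℕ.^ k ℕ.* weight D Q
tower-N⁻[] k D Q⁺ qk
  with Q , qkQ , c , w ← tower-shadow k D Q⁺ qk
  = Q , qkQ , (begin
    2 ℕ.* ∣ N⁻[_] (tower k D) Q⁺ ∣        ≡⟨ cong (2 ℕ.*_) (∣N⁻[]∣ (tower k D) Q⁺) ⟩
    2 ℕ.* (∣ Q⁺ ∣ ℕ.+ p)                  ≡⟨ regroup ∣ Q⁺ ∣ p ⟩
    ∣ Q⁺ ∣ ℕ.+ weight (tower k D) Q⁺      ≤⟨ ℕ.+-mono-≤ (ℕ.≤-trans c (∣p∣≤n Q)) w ⟩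
    order D ℕ.+ 3 ℕ.^ k ℕ.* weight D Q    ∎)
  where
  open ℕ.≤-Reasoning
  p = ∣ N⁻ (tower k D) Q⁺ ∣
  regroup : ∀ q p → 2 ℕ.* (q ℕ.+ p) ≡ q ℕ.+ (q ℕ.+ 2 ℕ.* p)
  regroup = ℕ-Ring.solve-∀

-- Dividing a bound for a digraph on N = n * T vertices by its scale T: both
-- sides are multiplied by 2T, and the surplus n together with the error 2ε
-- is absorbed into 2Tε because T ≥ 1 + K and n ≤ Kε.
descale : ∀ (a ε : ℚ) (n N c T w K : ℕ) → 0ℚ < ε →
          N ≡ n ℕ.* T → 2 ℕ.* c ℕ.≤ n ℕ.+ T ℕ.* w →
          fromℕ n ≤ fromℕ K * ε → 1 ℕ.+ K ℕ.≤ T →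
          a * fromℕ N ≤ fromℕ c + ε → a * fromℕ n ≤ half w + ε
descale a ε n N c T w K 0<ε refl 2c≤ n≤Kε K<T bound rewrite half≡ w =
  ℚ.*-cancelʳ-≤-pos (t + t) {{t+t>0}} (begin
    (a * n̂) * (t + t)
      ≡⟨ solve 3 (λ a n t → (a :* n) :* (t :+ t) := a :* (n :* t) :+ a :* (n :* t))
               refl a n̂ t ⟩
    a * (n̂ * t) + a * (n̂ * t)               ≤⟨ ℚ.+-mono-≤ bound′ bound′ ⟩
    (ĉ + ε) + (ĉ + ε)
      ≡⟨ solve 2 (λ c e → (c :+ e) :+ (c :+ e) := con (fromℕ 2) :* c :+ (e :+ e))
               refl ĉ ε ⟩
    fromℕ 2 * ĉ + (ε + ε)                   ≤⟨ ℚ.+-monoˡ-≤ (ε + ε) 2c≤′ ⟩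
    (n̂ + t * ŵ) + (ε + ε)                   ≤⟨ ℚ.+-monoˡ-≤ (ε + ε) (ℚ.+-monoˡ-≤ (t * ŵ) n≤Kε) ⟩
    (k * ε + t * ŵ) + (ε + ε)
      ≡⟨ solve 4 (λ k e t w → (k :* e :+ t :* w) :+ (e :+ e) := t :* w :+ ((con 1ℚ :+ k) :* e :+ con 1ℚ :* e))
               refl k ε t ŵ ⟩
    t * ŵ + ((1ℚ + k) * ε + 1ℚ * ε)         ≤⟨ ℚ.+-monoʳ-≤ (t * ŵ) (ℚ.+-mono-≤ (scale 1+k≤t) (scale 1≤t)) ⟩
    t * ŵ + (t * ε + t * ε)
      ≡⟨ solve 3 (λ t w e → t :* w :+ (t :* e :+ t :* e) := (con ½ :* w :+ e) :* (t :+ t))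
               refl t ŵ ε ⟩
    (½ * ŵ + ε) * (t + t)                   ∎)
  where
  open ℚ.≤-Reasoning
  open ℚ-Ring.+-*-Solver using (solve; con; _:+_; _:*_; _:=_)
  n̂ = fromℕ n
  ĉ = fromℕ c
  ŵ = fromℕ w
  t = fromℕ T
  k = fromℕ K
  bound′ : a * (n̂ * t) ≤ ĉ + ε
  bound′ = subst (λ z → a * z ≤ ĉ + ε) (fromℕ-homo-* n T) bound
  2c≤′ : fromℕ 2 * ĉ ≤ n̂ + t * ŵ
  2c≤′ = subst₂ _≤_ (fromℕ-homo-* 2 c)
    (trans (fromℕ-homo-+ n (T ℕ.* w)) (cong (λ z → n̂ + z) (fromℕ-homo-* T w))) (fromℕ-mono-≤ 2c≤)
  1+k≤t : 1ℚ + k ≤ t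
  1+k≤t = subst (_≤ t) (fromℕ-homo-+ 1 K) (fromℕ-mono-≤ K<T)
  1≤t : 1ℚ ≤ t
  1≤t = fromℕ-mono-≤ {1} {T} (ℕ.≤-trans (s≤s z≤n) K<T)
  scale : ∀ {x y} → x ≤ y → x * ε ≤ y * ε
  scale = ℚ.*-monoʳ-≤-nonNeg ε {{ℚ.nonNegative (ℚ.<⇒≤ 0<ε)}}
  t>0 : 0ℚ < t
  t>0 = ℚ.<-≤-trans (ℚ.positive⁻¹ 1ℚ) 1≤t
  t+t>0 : ℚ.Positive (t + t)
  t+t>0 = ℚ.positive (ℚ.+-mono-< t>0 t>0)

-- The height of the tower depends on ε and so does the quasi-kernel R that it
-- yields. The maximiser Q dominates every R, so it works for all ε at once.
IIIˢᶠ⇒IV : ∀ α → IIIˢᶠ α → IV α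
IIIˢᶠ⇒IV α III D =
  [ (λ none → contradiction (proj₂ some-quasiKernel) (none _))
  , (λ (Q , qk , maximal) → Q , qk , bound Q maximal)
  ]′ (argmax (quasiKernel? D) (weight D))
  where
  large⁺ : ∀ k → LargeClosedNbhd α (tower (suc k) D)
  large⁺ k = III (tower (suc k) D) (BlowUp.sinkFree (tower k D))

  some-quasiKernel : ∃ (QuasiKernel D)
  some-quasiKernel =
    let Q⁺ , qk⁺ , _ = large⁺ 0
        Q , qk , _   = tower-shadow 1 D Q⁺ qk⁺
    in Q , qk

  bound : ∀ Q → (∀ R → QuasiKernel D R → weight D R ℕ.≤ weight D Q) →
          α *ᴿ fromℚ (fromℕ (order D)) ≤ᴿ fromℚ (half ∣ Q ∣ + fromℕ ∣ N⁻ D Q ∣)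
  bound Q maximal ε 0<ε =
    let K , n≤Kε           = archimedean (order D) ε 0<ε
        Q⁺ , qk⁺ , bound⁺  = large⁺ K
        R , qkR , 2c≤      = tower-N⁻[] (suc K) D Q⁺ qk⁺
        M , boundₘ         = bound⁺ ε 0<ε
    in M , λ m M≤m → begin
      approx α m * fromℕ (order D)
        ≤⟨ descale (approx α m) ε (order D) (order (tower (suc K) D))
             ∣ N⁻[_] (tower (suc K) D) Q⁺ ∣
             (3 ℕ.^ suc K) (weight D R) K 0<ε (order-tower (suc K) D) 2c≤ n≤Kε
             (ℕ.≤-trans (ℕ.n≤1+n _) (1+k≤3^k (suc K))) (boundₘ m M≤m) ⟩
      half (weight D R) + ε
        ≤⟨ ℚ.+-monoˡ-≤ ε (half-mono-≤ (maximal R qkR)) ⟩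
      half (weight D Q) + ε
        ≡⟨ cong (_+ ε) (half-+ ∣ Q ∣ ∣ N⁻ D Q ∣) ⟨
      half ∣ Q ∣ + fromℕ ∣ N⁻ D Q ∣ + ε ∎
    where open ℚ.≤-Reasoning

weighted⇒closed : ∀ α D → LargeWeightedNbhd α D → LargeClosedNbhd α D
weighted⇒closed α D (Q , qk , large) = Q , qk , λ ε 0<ε →
  map₂ (λ b m M≤m → ℚ.≤-trans (b m M≤m) (ℚ.+-monoˡ-≤ ε value≤)) (large ε 0<ε)
  where
  open ℚ.≤-Reasoning
  value≤ : half ∣ Q ∣ + fromℕ ∣ N⁻ D Q ∣ ≤ fromℕ ∣ N⁻[_] D Q ∣
  value≤ = begin
    half ∣ Q ∣ + fromℕ ∣ N⁻ D Q ∣     ≤⟨ ℚ.+-monoˡ-≤ (fromℕ ∣ N⁻ D Q ∣) (half≤fromℕ ∣ Q ∣) ⟩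
    fromℕ ∣ Q ∣ + fromℕ ∣ N⁻ D Q ∣    ≡⟨ fromℕ-homo-+ ∣ Q ∣ ∣ N⁻ D Q ∣ ⟨
    fromℕ (∣ Q ∣ ℕ.+ ∣ N⁻ D Q ∣)      ≡⟨ cong fromℕ (∣N⁻[]∣ D Q) ⟨
    fromℕ ∣ N⁻[_] D Q ∣               ∎

proposition1p6 : ((α : ℝ) → fromℚ 0ℚ <ᴿ α → α ≤ᴿ fromℚ ½ →
    (III α ⇔ IV α) × (III α ⇔ IIIˢᶠ α) × (IV α ⇔ IVˢᶠ α))
    ×
    ((D : Digraph) → ∃ λ (I : Subset (order D)) → Independent D I ×
    half (order D) ≤ half ∣ I ∣ + fromℕ ∣ N⁻ D I ∣)
proposition1p6 = (λ α _ _ →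
    mk⇔ (IIIˢᶠ⇒IV α ∘ III⇒IIIˢᶠ α) (IV⇒III α)
  , mk⇔ (III⇒IIIˢᶠ α) (IV⇒III α ∘ IIIˢᶠ⇒IV α)
  , mk⇔ (λ IV D _ → IV D) (λ IVˢᶠ → IIIˢᶠ⇒IV α λ D sf → weighted⇒closed α D (IVˢᶠ D sf)))
  , λ D → case independent-weight≥order D of λ where
      (I , indep , n≤w) → I , indep ,
        subst (half (order D) ≤_) (sym (half-+ ∣ I ∣ ∣ N⁻ D I ∣)) (half-mono-≤ n≤w)
  where
  III⇒IIIˢᶠ : ∀ α → III α → IIIˢᶠ α
  III⇒IIIˢᶠ α III D _ = III D
  IV⇒III : ∀ α → IV α → III α
  IV⇒III α IV D = weighted⇒closed α D (IV D)
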